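{- There exists a deterministic distributed algorithm for the maximum coverage problem that, for any integer $r\ge1$, computes an $O(r\cdot k^{1/(r+1)})$-approximation in $r$ rounds and with $\widetilde O(n)$ communication per machine.
   Context: Maximum coverage: given sets $S_1,\dots,S_m\subseteq[n]$ and an integer $k$, find $k$ of the sets whose union has maximum size; an $\alpha$-approximation is a choice of at most $k$ sets covering at least a $1/\alpha$ fraction of the optimum. Distributed (coordinator) model: the collection of sets is partitioned arbitrarily (adversarially) across $p$ machines. Computation proceeds in synchronous rounds: in each round all machines simultaneously send a message to a central coordinator, which then communicates back to all machines a summary for the next round; at the end of the last round the coordinator outputs the answer. Communication per machine is the total number of bits communicated by each machine (with the coordinator). There is no bound on local computation beyond what is needed for correctness. $\widetilde O(\cdot)$ hides polylogarithmic factors. -}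

module Defs where

open import Algebra.Definitions.RawSemiring using (_^_)
open import Data.Bool.Base using (Bool; if_then_else_)
open import Data.Fin.Base using (Fin)
open import Data.Fin.Properties using (_≟_)
open import Data.Fin.Subset using (Subset; ⋃; ∣_∣)
open import Data.Fin.Subset.Properties using (_∈?_)
open import Data.Integer.Base using (+_)
open import Data.List.Base using (List; []; _∷_; allFin; filter; length; map; sum)
open import Data.Maybe.Base using (Maybe; just; nothing)
open import Data.Nat.Base as ℕ using (ℕ; zero; suc; _+_; _∸_)
open import Data.Nat.Logarithm using (⌈log₂_⌉)
open import Data.Product.Base using (_×_; ∃-syntax)
open import Data.Rational.Base as ℚ using (ℚ; 0ℚ)
open import Relation.Nullary.Decidable.Core using (does)

------------------------------------------------------------------------
-- Maximum coverage

-- An indexed family, so the same set may occur more than once.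
SetFamily : (n m : ℕ) → Set
SetFamily n m = Fin m → Subset n

coverage : ∀ {n m} → SetFamily n m → Subset m → ℕ
coverage S T = ∣ ⋃ (map S (filter (_∈? T) (allFin _))) ∣

-- Choosing at most k sets has the same optimum as choosing exactly k when
-- k ≤ m, and is also meaningful when k > m.
Optimal : ∀ {n m} → SetFamily n m → ℕ → Subset m → Set
Optimal S k T =
  ∣ T ∣ ℕ.≤ k × (∀ T′ → ∣ T′ ∣ ℕ.≤ k → coverage S T′ ℕ.≤ coverage S T)

ℕ→ℚ : ℕ → ℚ
ℕ→ℚ a = + a ℚ./ 1

IsApproximation : ∀ {n m} → ℚ → SetFamily n m → ℕ → Subset m → Set
IsApproximation α S k T =
  ∣ T ∣ ℕ.≤ k ×
  (∀ T* → Optimal S k T* →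
    ℕ→ℚ (coverage S T*) ℚ.≤ α ℚ.* ℕ→ℚ (coverage S T))

------------------------------------------------------------------------
-- The coordinator model

Bits : Set
Bits = List Bool

-- A machine sees the identifiers in [m] of the sets it holds, together with
-- the contents of those sets.
LocalInput : (n m : ℕ) → Set
LocalInput n m = Fin m → Maybe (Subset n)

-- Histories are listed most recent first.  Parties carry no explicit memory:
-- being deterministic, they can recompute any past state from their input and
-- what they have received so far.
record Protocol (n m p : ℕ) : Set where
  field
    machine     : Fin p → LocalInput n m → (summaries : List Bits) → Bits
    coordinator : (received : List (Fin p → Bits)) → Bits
    output      : (received : List (Fin p → Bits)) → Subset m

-- A set is held by exactly one machine; an arbitrary map to machines is an
-- arbitrary partition of the collection, possibly with empty parts.
Partition : (m p : ℕ) → Set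
Partition m p = Fin m → Fin p

localInput : ∀ {n m p} → SetFamily n m → Partition m p → Fin p → LocalInput n m
localInput S owner j i = if does (owner i ≟ j) then just (S i) else nothing

module Execution {n m p : ℕ} (P : Protocol n m p)
                 (S : SetFamily n m) (owner : Partition m p) where
  open Protocol P

  -- What the coordinator has received, and what it has sent back, after t
  -- complete rounds.
  mutual
    received : ℕ → List (Fin p → Bits)
    received zero    = []
    received (suc t) =
      (λ j → machine j (localInput S owner j) (summaries t)) ∷ received t

    summaries : ℕ → List Bits
    summaries zero    = []
    summaries (suc t) = coordinator (received (suc t)) ∷ summaries t

  result : (rounds : ℕ) → Subset m
  result r = output (received r)

  -- Bits in both directions over all rounds.  The coordinator outputs at the
  -- end of the last round, so there are only r ∸ 1 summaries.
  communication : (rounds : ℕ) → Fin p → ℕ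
  communication r j =
    sum (map (λ msgs → length (msgs j)) (received r)) +
    sum (map length (summaries (r ∸ 1)))

open Execution public using (result; communication)

-- The parameters are public; the family and its partition are not.
Algorithm : Set
Algorithm = (r n m p k : ℕ) → Protocol n m p

------------------------------------------------------------------------
-- Asymptotic bounds

infixr 8 _^ℚ_
_^ℚ_ : ℚ → ℕ → ℚ
_^ℚ_ = _^_ ℚ.+-*-rawSemiring

-- α(r,k) = O(r · k^{1/(r+1)}): for some constant C and all r ≥ 1 and k,
-- 0 ≤ α(r,k) ≤ C · r · k^{1/(r+1)}, the root being expressed by raising the
-- (nonnegative) two sides to the power r+1.
IsO[r·k^1/[r+1]] : (ℕ → ℕ → ℚ) → Set
IsO[r·k^1/[r+1]] α =
  ∃[ C ] ∀ r k → r ℕ.≥ 1 →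
    0ℚ ℚ.≤ α r k ×
    α r k ^ℚ suc r ℚ.≤ ℕ→ℚ ((C ℕ.* r) ℕ.^ suc r ℕ.* k)

-- b(n,m) = Õ(n), with factors polylogarithmic in the instance size (n and m)
-- hidden; the 2 only keeps the logarithm positive.
IsÕ[n] : (ℕ → ℕ → ℕ) → Set
IsÕ[n] b =
  ∃[ C ] ∃[ c ] ∀ n m → b n m ℕ.≤ C ℕ.* n ℕ.* ⌈log₂ (2 + n + m) ⌉ ℕ.^ c

{-# OPTIONS --safe #-}
module Submission where

open import Defs
open import Data.Bool.Base using (Bool; true; false; if_then_else_) renaming (T to IsTrue)
open import Data.Fin.Base
  using (Fin; zero; suc; toℕ; fromℕ<; inject≤; remQuot; combine)
open import Data.Fin.Properties as Fin using (any?)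
open import Data.Fin.Subset
  using (Subset; inside; outside; _∈_; _∉_; _⊆_; ⊤; ⊥; _∩_; _∪_; _─_; ⋃; ∣_∣; ⁅_⁆)
open import Data.Fin.Subset.Properties as Subset
  using (_∈?_; p⊆q⇒∣p∣≤∣q∣; x∈p∪q⁺; x∈p∪q⁻; x∈p∩q⁺; x∈p∩q⁻; p─q⊆p; x∈p∧x∉q⇒x∈p─q; ∉⊥;
         ∣p─q∣≤∣p∣)
import Data.Integer.Base as ℤ
import Data.Integer.Properties as ℤ
open import Data.List.Base
  using (List; []; _∷_; _++_; allFin; cartesianProductWith; drop; filter; length; map)
open import Data.List.Membership.Propositional using () renaming (_∈_ to _∈ᴸ_)
open import Data.List.Membership.Propositional.Properties
  using (∈-allFin; ∈-map∘filter⁻; ∈-map∘filter⁺; ∈-cartesianProductWith⁺; ∈-cartesianProductWith⁻)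
open import Data.List.Properties using (length-++; ++-assoc; ++-identityʳ)
open import Data.List.Relation.Unary.All as All using (All; []; _∷_)
import Data.List.Relation.Unary.AllPairs as AllPairs
open import Data.List.Relation.Unary.Any as Any using (Any; here; there)
open import Data.List.Relation.Unary.Unique.Propositional using (Unique)
open import Data.List.Relation.Unary.Unique.Propositional.Properties using (allFin⁺)
open import Data.Maybe.Base using (Maybe; just; nothing)
import Data.Maybe.Properties as Maybe
open import Data.Nat.Base
open import Data.Nat.DivMod using (_/_; m/n*n≤m; /-monoˡ-≤; m*n/n≡m)
open import Data.Nat.Induction using (<-rec)
open import Data.Nat.ListAction using (sum)
open import Data.Nat.Logarithm using (⌈log₂_⌉; ⌈log₂⌉-mono-≤; ⌈log₂⌈n/2⌉⌉≡⌈log₂n⌉∸1)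
open import Data.Nat.Properties
open import Data.Nat.Tactic.RingSolver using (solve-∀)
open import Data.Product.Base using (_×_; _,_; proj₁; proj₂; uncurry; ∃-syntax; Σ-syntax)
open import Data.Rational.Base as ℚ using (ℚ)
import Data.Rational.Properties as ℚ
open import Data.Rational.Unnormalised.Base as ℚᵘ using (mkℚᵘ; *≤*)
import Data.Rational.Unnormalised.Properties as ℚᵘ
open import Data.Sum.Base using (_⊎_; inj₁; inj₂)
open import Data.Vec.Base as Vec using (Vec; []; _∷_; lookup; here; there)
import Data.Vec.Properties as Vec
open import Function.Base using (_∘_; case_of_)
open import Level using (Level)
open import Relation.Binary.PropositionalEquality
open import Relation.Nullary
open import Relation.Nullary.Decidable using (dec-true; dec-false)
open import Relation.Unary using (Pred; Decidable)

-- Fix a base a ≥ 2 with k ≤ a ^ (r + 1) and a threshold τ.  In each round a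
-- machine scans its sets, restricted to the elements it still cares about, and
-- sends the new part of every one that contributes at least τ new elements.  The
-- coordinator keeps a received piece if it adds at least τ / a elements, and
-- broadcasts what it has covered; a machine then cares only about the elements
-- that it sent but the coordinator did not cover.  That remainder shrinks by the
-- factor a each round.  Suppose the final answer covers v elements.  Either some
-- k pieces contributing τ / a each give k τ ≤ a v, or both the coordinator's
-- cover and each machine's first message have size O(v).  In the latter case
-- each of the k optimal sets loses at most r (τ ∸ 1) elements to the threshold
-- and O(v / a ^ r) = O(a v / k) to its machine's final remainder, so that
-- OPT ≤ v + r k (τ ∸ 1) + O(a v).  Guessing τ as a power of two near OPT / (r k)
-- makes OPT = O(r a v) in both cases.

-- Finite subsets

module _ {ℓ : Level} {n : ℕ} {P : Pred (Fin n) ℓ} (P? : Decidable P) where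

  ⟪_⟫ : Subset n
  ⟪_⟫ = Vec.tabulate (does ∘ P?)

  ∈⟪⟫⁺ : ∀ {x} → P x → x ∈ ⟪_⟫
  ∈⟪⟫⁺ {x} px = Vec.lookup⇒[]= x _ (trans (Vec.lookup∘tabulate _ x) (dec-true (P? x) px))

  ∈⟪⟫⁻ : ∀ {x} → x ∈ ⟪_⟫ → P x
  ∈⟪⟫⁻ {x} x∈ with P? x in eq
  ... | yes px = px
  ... | no _ with () ← trans (sym (Vec.[]=⇒lookup x∈)) (trans (Vec.lookup∘tabulate _ x) (cong does eq))

x∈p─q⇒x∉q : ∀ {n} {x : Fin n} (p q : Subset n) → x ∈ p ─ q → x ∉ q
x∈p─q⇒x∉q (_ ∷ p) (_ ∷ q) (there x∈p─q) (there x∈q) = x∈p─q⇒x∉q p q x∈p─q x∈q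

∣p─q∣+∣q∣≡∣p∪q∣ : ∀ {n} (p q : Subset n) → ∣ p ─ q ∣ + ∣ q ∣ ≡ ∣ p ∪ q ∣
∣p─q∣+∣q∣≡∣p∪q∣ [] [] = refl
∣p─q∣+∣q∣≡∣p∪q∣ (inside ∷ p) (inside ∷ q) = trans (+-suc _ _) (cong suc (∣p─q∣+∣q∣≡∣p∪q∣ p q))
∣p─q∣+∣q∣≡∣p∪q∣ (inside ∷ p) (outside ∷ q) = cong suc (∣p─q∣+∣q∣≡∣p∪q∣ p q)
∣p─q∣+∣q∣≡∣p∪q∣ (outside ∷ p) (inside ∷ q) = trans (+-suc _ _) (cong suc (∣p─q∣+∣q∣≡∣p∪q∣ p q))
∣p─q∣+∣q∣≡∣p∪q∣ (outside ∷ p) (outside ∷ q) = ∣p─q∣+∣q∣≡∣p∪q∣ p q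

module _ {n : ℕ} where

  ∣p∪q∣≤∣p∣+∣q∣ : (p q : Subset n) → ∣ p ∪ q ∣ ≤ ∣ p ∣ + ∣ q ∣
  ∣p∪q∣≤∣p∣+∣q∣ p q = begin
    ∣ p ∪ q ∣          ≡⟨ ∣p─q∣+∣q∣≡∣p∪q∣ p q ⟨
    ∣ p ─ q ∣ + ∣ q ∣  ≤⟨ +-monoˡ-≤ _ (∣p─q∣≤∣p∣ p q) ⟩
    ∣ p ∣ + ∣ q ∣      ∎
    where open ≤-Reasoning

  p⊆q∪r⇒∣p∣≤∣q∣+∣r∣ : ∀ {p} (q r : Subset n) → p ⊆ q ∪ r → ∣ p ∣ ≤ ∣ q ∣ + ∣ r ∣
  p⊆q∪r⇒∣p∣≤∣q∣+∣r∣ q r p⊆q∪r = ≤-trans (p⊆q⇒∣p∣≤∣q∣ p⊆q∪r) (∣p∪q∣≤∣p∣+∣q∣ q r)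

  p⊆[p─q]∪q : (p q : Subset n) → p ⊆ (p ─ q) ∪ q
  p⊆[p─q]∪q p q {x} x∈p with x ∈? q
  ... | yes x∈q = x∈p∪q⁺ (inj₂ x∈q)
  ... | no x∉q  = x∈p∪q⁺ (inj₁ (x∈p∧x∉q⇒x∈p─q x∈p x∉q))

  ∣p∣≤∣p─q∣+∣q∣ : (p q : Subset n) → ∣ p ∣ ≤ ∣ p ─ q ∣ + ∣ q ∣
  ∣p∣≤∣p─q∣+∣q∣ p q = p⊆q∪r⇒∣p∣≤∣q∣+∣r∣ (p ─ q) q (p⊆[p─q]∪q p q)

  p⊆q⇒∣p─q∣≡0 : ∀ {p q : Subset n} → p ⊆ q → ∣ p ─ q ∣ ≡ 0
  p⊆q⇒∣p─q∣≡0 {p} {q} p⊆q = n≤0⇒n≡0 (≤-trans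
    (p⊆q⇒∣p∣≤∣q∣ {q = ⊥} λ x∈ → contradiction (p⊆q (p─q⊆p p q x∈)) (x∈p─q⇒x∉q p q x∈))
    (≤-reflexive (Subset.∣⊥∣≡0 n)))

  p⊆q⇒a*∣p─q∣≤b : ∀ a {b} {p q : Subset n} → p ⊆ q → a * ∣ p ─ q ∣ ≤ b
  p⊆q⇒a*∣p─q∣≤b a p⊆q = ≤-trans (≤-reflexive (trans (cong (a *_) (p⊆q⇒∣p─q∣≡0 p⊆q)) (*-zeroʳ a))) z≤n

  ∈⋃⁺ : ∀ {x} {ps : List (Subset n)} {p} → p ∈ᴸ ps → x ∈ p → x ∈ ⋃ ps
  ∈⋃⁺ (here refl) x∈p = x∈p∪q⁺ (inj₁ x∈p)
  ∈⋃⁺ (there p∈)  x∈p = x∈p∪q⁺ (inj₂ (∈⋃⁺ p∈ x∈p))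

  ∈⋃⁻ : ∀ {x} (ps : List (Subset n)) → x ∈ ⋃ ps → ∃[ p ] p ∈ᴸ ps × x ∈ p
  ∈⋃⁻ []       x∈ = contradiction x∈ ∉⊥
  ∈⋃⁻ (p ∷ ps) x∈ with x∈p∪q⁻ p _ x∈
  ... | inj₁ x∈p = p , here refl , x∈p
  ... | inj₂ x∈ps with ∈⋃⁻ ps x∈ps
  ...   | q , q∈ps , x∈q = q , there q∈ps , x∈q

-- Coverage

module _ {n m : ℕ} (S : SetFamily n m) (T : Subset m) where

  covered : Subset n
  covered = ⋃ (map S (filter (_∈? T) (allFin m)))

  ∈covered⁺ : ∀ {x s} → s ∈ T → x ∈ S s → x ∈ covered
  ∈covered⁺ {s = s} s∈T x∈S =
    ∈⋃⁺ (∈-map∘filter⁺ S (_∈? T) {f = S} {xs = allFin m} (s , ∈-allFin s , refl , s∈T)) x∈S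

  ∈covered⁻ : ∀ {x} → x ∈ covered → ∃[ s ] s ∈ T × x ∈ S s
  ∈covered⁻ x∈ with ∈⋃⁻ _ x∈
  ... | p , p∈ , x∈p with ∈-map∘filter⁻ S (_∈? T) {f = S} {xs = allFin m} p∈
  ...   | s , _ , refl , s∈T = s , s∈T , x∈p

coverage-mono : ∀ {n m} {K S : SetFamily n m} (T : Subset m) →
                (∀ s → K s ⊆ S s) → coverage K T ≤ coverage S T
coverage-mono {K = K} {S} T K⊆S = p⊆q⇒∣p∣≤∣q∣ {p = covered K T} λ x∈ →
  let s , s∈T , x∈K = ∈covered⁻ K T x∈ in ∈covered⁺ S T s∈T (K⊆S s x∈K)

-- Induction on `T`, removing the first chosen set from `A`: what is left is covered by the later
-- sets. Taking `A` arbitrary, not the whole covered region, lets the hypothesis apply to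
-- `A ─ S zero`.
union-bound : ∀ {n m B} (S : SetFamily n m) (T : Subset m) (A : Subset n) →
              (∀ {x} → x ∈ A → ∃[ s ] s ∈ T × x ∈ S s) → (∀ s → ∣ S s ∣ ≤ B) →
              ∣ A ∣ ≤ ∣ T ∣ * B
union-bound {n} S [] A cover _ =
  ≤-trans (p⊆q⇒∣p∣≤∣q∣ {q = ⊥} λ x∈A → case cover x∈A of λ ()) (≤-reflexive (Subset.∣⊥∣≡0 n))
union-bound S (outside ∷ T) A cover bound =
  union-bound (S ∘ suc) T A
    (λ x∈A → case cover x∈A of λ { (suc s , there s∈T , x∈S) → s , s∈T , x∈S })
    (bound ∘ suc)
union-bound {B = B} S (inside ∷ T) A cover bound = begin
  ∣ A ∣                               ≤⟨ ∣p∣≤∣p─q∣+∣q∣ A (S zero) ⟩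
  ∣ A ─ S zero ∣ + ∣ S zero ∣         ≤⟨ +-mono-≤ tail (bound zero) ⟩
  ∣ T ∣ * B + B                       ≡⟨ +-comm _ B ⟩
  B + ∣ T ∣ * B                       ∎
  where
  open ≤-Reasoning
  tail : ∣ A ─ S zero ∣ ≤ ∣ T ∣ * B
  tail = union-bound (S ∘ suc) T (A ─ S zero)
    (λ x∈ → case cover (p─q⊆p A (S zero) x∈) of λ
      { (zero  , _ , x∈S)         → contradiction x∈S (x∈p─q⇒x∉q A (S zero) x∈)
      ; (suc s , there s∈T , x∈S) → s , s∈T , x∈S })
    (bound ∘ suc)

coverage≤∣X∣+∣T∣*B : ∀ {n m B} (S : SetFamily n m) (T : Subset m) (X : Subset n) →
                     (∀ s → ∣ S s ─ X ∣ ≤ B) → coverage S T ≤ ∣ X ∣ + ∣ T ∣ * B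
coverage≤∣X∣+∣T∣*B {B = B} S T X bound = begin
  ∣ covered S T ∣                ≤⟨ ∣p∣≤∣p─q∣+∣q∣ (covered S T) X ⟩
  ∣ covered S T ─ X ∣ + ∣ X ∣
    ≤⟨ +-monoˡ-≤ _ (union-bound (λ s → S s ─ X) T (covered S T ─ X) cover bound) ⟩
  ∣ T ∣ * B + ∣ X ∣              ≡⟨ +-comm _ ∣ X ∣ ⟩
  ∣ X ∣ + ∣ T ∣ * B              ∎
  where
  open ≤-Reasoning
  cover : ∀ {x} → x ∈ covered S T ─ X → ∃[ s ] s ∈ T × x ∈ S s ─ X
  cover x∈ with ∈covered⁻ S T (p─q⊆p (covered S T) X x∈)
  ... | s , s∈T , x∈S = s , s∈T , x∈p∧x∉q⇒x∈p─q x∈S (x∈p─q⇒x∉q (covered S T) X x∈)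

-- Optimal choices by exhaustive search

argmax : ∀ {m} → (Subset m → ℕ) → Subset m
argmax {zero}  f = []
argmax {suc m} f =
  let p = inside ∷ argmax (f ∘ (inside ∷_)); q = outside ∷ argmax (f ∘ (outside ∷_))
  in if f p ≤ᵇ f q then q else p

argmax-maximal : ∀ {m} (f : Subset m → ℕ) T → f T ≤ f (argmax f)
argmax-maximal {zero}  f [] = ≤-refl
argmax-maximal {suc m} f (b ∷ T)
  with f (inside ∷ argmax (f ∘ (inside ∷_))) ≤ᵇ f (outside ∷ argmax (f ∘ (outside ∷_))) in eq
argmax-maximal f (inside  ∷ T) | true  =
  ≤-trans (argmax-maximal (f ∘ (inside ∷_)) T) (≤ᵇ⇒≤ _ _ (subst IsTrue (sym eq) _))
argmax-maximal f (outside ∷ T) | true  = argmax-maximal (f ∘ (outside ∷_)) T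
argmax-maximal f (inside  ∷ T) | false = argmax-maximal (f ∘ (inside ∷_)) T
argmax-maximal f (outside ∷ T) | false =
  ≤-trans (argmax-maximal (f ∘ (outside ∷_)) T) (<⇒≤ (≰⇒> λ le → subst IsTrue eq (≤⇒≤ᵇ le)))

module _ {n m : ℕ} (S : SetFamily n m) (k : ℕ) where

  -- The successor ranks every admissible choice above the inadmissible ones.
  private
    score : Subset m → ℕ
    score T = if ∣ T ∣ ≤ᵇ k then suc (coverage S T) else 0

    score-≤ : ∀ {T} → ∣ T ∣ ≤ k → score T ≡ suc (coverage S T)
    score-≤ {T} T≤k with ∣ T ∣ ≤ᵇ k in eq
    ... | true  = refl
    ... | false = contradiction (subst IsTrue eq (≤⇒≤ᵇ T≤k)) λ ()

    score-> : ∀ {T} → 0 < score T → ∣ T ∣ ≤ k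
    score-> {T} 0<score with ∣ T ∣ ≤ᵇ k in eq
    ... | true  = ≤ᵇ⇒≤ _ _ (subst IsTrue (sym eq) _)
    ... | false = contradiction 0<score λ ()

  -- Brute force is legitimate, since the model leaves local computation unbounded.
  optimum : Subset m
  optimum = argmax score

  optimum-optimal : Optimal S k optimum
  optimum-optimal = optimum≤k , λ T T≤k → s≤s⁻¹ (begin
    suc (coverage S T)        ≡⟨ score-≤ T≤k ⟨
    score T                   ≤⟨ argmax-maximal score T ⟩
    score optimum             ≡⟨ score-≤ optimum≤k ⟩
    suc (coverage S optimum)  ∎)
    where
    open ≤-Reasoning
    optimum≤k : ∣ optimum ∣ ≤ k
    -- The empty choice is admissible, so the maximal score is positive, and only admissible choices
    -- have a positive score.
    optimum≤k = score-> (begin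
      1                       ≤⟨ s≤s z≤n ⟩
      suc (coverage S ⊥)      ≡⟨ score-≤ (≤-trans (≤-reflexive (Subset.∣⊥∣≡0 m)) z≤n) ⟨
      score ⊥                 ≤⟨ argmax-maximal score ⊥ ⟩
      score optimum           ∎)

-- Assignments of elements to the sets that cover them

-- Each element names at most one set, so the pieces of a message are disjoint and a message costs
-- only n identifiers, however many sets contribute.
Assignment : (n m : ℕ) → Set
Assignment n m = Vec (Maybe (Fin m)) n

module _ {n m : ℕ} where

  _≟ᴹ_ : (x y : Maybe (Fin m)) → Dec (x ≡ y)
  _≟ᴹ_ = Maybe.≡-dec Fin._≟_

  abstract
    fiber : Assignment n m → Fin m → Subset n
    fiber f s = ⟪ (λ x → lookup f x ≟ᴹ just s) ⟫

    dom : Assignment n m → Subset n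
    dom f = ⟪ (λ x → any? λ s → lookup f x ≟ᴹ just s) ⟫

    ∈fiber⁺ : ∀ {f s x} → lookup f x ≡ just s → x ∈ fiber f s
    ∈fiber⁺ {f} {s} = ∈⟪⟫⁺ (λ x → lookup f x ≟ᴹ just s)

    ∈fiber⁻ : ∀ {f s x} → x ∈ fiber f s → lookup f x ≡ just s
    ∈fiber⁻ {f} {s} = ∈⟪⟫⁻ (λ x → lookup f x ≟ᴹ just s)

    ∈dom⁺ : ∀ {f s x} → x ∈ fiber f s → x ∈ dom f
    ∈dom⁺ {f} {s} x∈ = ∈⟪⟫⁺ (λ x → any? λ s → lookup f x ≟ᴹ just s) (s , ∈fiber⁻ {f} x∈)

    ∈dom⁻ : ∀ {f x} → x ∈ dom f → ∃[ s ] x ∈ fiber f s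
    ∈dom⁻ {f} x∈ with ∈⟪⟫⁻ (λ x → any? λ s → lookup f x ≟ᴹ just s) x∈
    ... | s , eq = s , ∈fiber⁺ {f} eq

  -- The fibers are disjoint with union `dom f`, so the inequalities for the single fibers add up.
  ∣dom─X∣-fiberwise : ∀ a f (X : Subset n) → (∀ s → a * ∣ fiber f s ─ X ∣ ≤ ∣ fiber f s ∣) →
                      a * ∣ dom f ─ X ∣ ≤ ∣ dom f ∣
  ∣dom─X∣-fiberwise a f X thin with part (allFin m) (allFin⁺ m)
    where
    -- `D` is the union of the fibers over `L`. Uniqueness of `L` makes each new fiber disjoint from
    -- the previous `D`, which is what turns the sum of sizes into the size of the union.
    part : ∀ L → Unique L →
           ∃[ D ] (∀ {x} → x ∈ D → ∃[ s ] s ∈ᴸ L × x ∈ fiber f s) ×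
                  (∀ {s} → s ∈ᴸ L → fiber f s ⊆ D) × a * ∣ D ─ X ∣ ≤ ∣ D ∣
    part [] _ = ⊥ , (λ x∈ → contradiction x∈ ∉⊥) , (λ ()) ,
      p⊆q⇒a*∣p─q∣≤b a {p = ⊥} {X} λ x∈ → contradiction x∈ ∉⊥
    part (s ∷ L) (s∉L AllPairs.∷ uniq) with part L uniq
    ... | D , D⊆ , ⊆D , thinD = fiber f s ∪ D , sub , sup , (begin
      a * ∣ (fiber f s ∪ D) ─ X ∣
        ≤⟨ *-monoʳ-≤ a (p⊆q∪r⇒∣p∣≤∣q∣+∣r∣ (fiber f s ─ X) (D ─ X) split) ⟩
      a * (∣ fiber f s ─ X ∣ + ∣ D ─ X ∣)        ≡⟨ *-distribˡ-+ a _ _ ⟩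
      a * ∣ fiber f s ─ X ∣ + a * ∣ D ─ X ∣      ≤⟨ +-mono-≤ (thin s) thinD ⟩
      ∣ fiber f s ∣ + ∣ D ∣
        ≤⟨ +-monoˡ-≤ _ (p⊆q⇒∣p∣≤∣q∣ {p = fiber f s} disjoint) ⟩
      ∣ fiber f s ─ D ∣ + ∣ D ∣                  ≡⟨ ∣p─q∣+∣q∣≡∣p∪q∣ (fiber f s) D ⟩
      ∣ fiber f s ∪ D ∣                          ∎)
      where
      open ≤-Reasoning
      sub : ∀ {x} → x ∈ fiber f s ∪ D → ∃[ s′ ] s′ ∈ᴸ (s ∷ L) × x ∈ fiber f s′
      sub x∈ with x∈p∪q⁻ (fiber f s) D x∈
      ... | inj₁ x∈s = s , here refl , x∈s
      ... | inj₂ x∈D with D⊆ x∈D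
      ...   | s′ , s′∈ , x∈s′ = s′ , there s′∈ , x∈s′
      sup : ∀ {s′} → s′ ∈ᴸ (s ∷ L) → fiber f s′ ⊆ fiber f s ∪ D
      sup (here refl) x∈ = x∈p∪q⁺ (inj₁ x∈)
      sup (there s′∈) x∈ = x∈p∪q⁺ (inj₂ (⊆D s′∈ x∈))
      split : (fiber f s ∪ D) ─ X ⊆ (fiber f s ─ X) ∪ (D ─ X)
      split x∈ with x∈p∪q⁻ (fiber f s) D (p─q⊆p (fiber f s ∪ D) X x∈)
      ... | inj₁ x∈s = x∈p∪q⁺ (inj₁ (x∈p∧x∉q⇒x∈p─q x∈s (x∈p─q⇒x∉q (fiber f s ∪ D) X x∈)))
      ... | inj₂ x∈D = x∈p∪q⁺ (inj₂ (x∈p∧x∉q⇒x∈p─q x∈D (x∈p─q⇒x∉q (fiber f s ∪ D) X x∈)))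
      disjoint : fiber f s ⊆ fiber f s ─ D
      disjoint x∈s = x∈p∧x∉q⇒x∈p─q x∈s λ x∈D → let s′ , s′∈ , x∈s′ = D⊆ x∈D in
        All.lookup s∉L s′∈ (Maybe.just-injective (trans (sym (∈fiber⁻ x∈s)) (∈fiber⁻ x∈s′)))
  ... | D , D⊆ , ⊆D , thinD = begin
    a * ∣ dom f ─ X ∣   ≤⟨ *-monoʳ-≤ a (p⊆q⇒∣p∣≤∣q∣ {p = dom f ─ X} dom─X⊆D─X) ⟩
    a * ∣ D ─ X ∣       ≤⟨ thinD ⟩
    ∣ D ∣               ≤⟨ p⊆q⇒∣p∣≤∣q∣ {p = D} (λ x∈ → let _ , _ , x∈s = D⊆ x∈ in ∈dom⁺ x∈s) ⟩
    ∣ dom f ∣           ∎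
    where
    open ≤-Reasoning
    dom⊆D : dom f ⊆ D
    dom⊆D x∈ = let s , x∈s = ∈dom⁻ x∈ in ⊆D (∈-allFin s) x∈s
    dom─X⊆D─X : dom f ─ X ⊆ D ─ X
    dom─X⊆D─X x∈ =
      x∈p∧x∉q⇒x∈p─q (dom⊆D (p─q⊆p (dom f) X x∈)) (x∈p─q⇒x∉q (dom f) X x∈)

  abstract
    assign : Fin m → Subset n → Assignment n m → Assignment n m
    assign i D f = Vec.tabulate λ x → if does (x ∈? D) then just i else lookup f x

  module _ {i : Fin m} {D : Subset n} {f : Assignment n m} where

    abstract
      lookup-assign-∈ : ∀ {x} → x ∈ D → lookup (assign i D f) x ≡ just i
      lookup-assign-∈ {x} x∈D = trans (Vec.lookup∘tabulate _ x)
        (cong (if_then just i else lookup f x) (dec-true (x ∈? D) x∈D))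

      lookup-assign-∉ : ∀ {x} → x ∉ D → lookup (assign i D f) x ≡ lookup f x
      lookup-assign-∉ {x} x∉D = trans (Vec.lookup∘tabulate _ x)
        (cong (if_then just i else lookup f x) (dec-false (x ∈? D) x∉D))

    ∈fiber-assign-∈ : ∀ {s x} → x ∈ D → x ∈ fiber (assign i D f) s → i ≡ s
    ∈fiber-assign-∈ x∈D x∈ = Maybe.just-injective (trans (sym (lookup-assign-∈ x∈D)) (∈fiber⁻ x∈))

    ∈fiber-assign-∉ : ∀ {s x} → x ∉ D → x ∈ fiber (assign i D f) s → x ∈ fiber f s
    ∈fiber-assign-∉ x∉D x∈ = ∈fiber⁺ (trans (sym (lookup-assign-∉ x∉D)) (∈fiber⁻ x∈))

-- The sketch sent by a machine

module Sketch {n m : ℕ} (τ : ℕ) (I : LocalInput n m) (U : Subset n) where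

  extend : Fin m → Maybe (Subset n) → Assignment n m → Assignment n m
  extend i nothing  f = f
  extend i (just A) f with τ ≤? ∣ (A ∩ U) ─ dom f ∣
  ... | yes _ = assign i ((A ∩ U) ─ dom f) f
  ... | no  _ = f

  sketch : List (Fin m) → Assignment n m
  sketch []       = Vec.replicate n nothing
  sketch (i ∷ is) = extend i (I i) (sketch is)

  -- A newly assigned piece avoids `dom f`, so no element is ever reassigned.
  fiber⊆extend : ∀ i M f s → fiber f s ⊆ fiber (extend i M f) s
  fiber⊆extend i nothing  f s x∈ = x∈
  fiber⊆extend i (just A) f s x∈ with τ ≤? ∣ (A ∩ U) ─ dom f ∣
  ... | no  _ = x∈
  ... | yes _ = ∈fiber⁺ (trans (lookup-assign-∉ x∉) (∈fiber⁻ x∈))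
    where x∉ = λ x∈D → x∈p─q⇒x∉q (A ∩ U) (dom f) x∈D (∈dom⁺ x∈)

  dom⊆extend : ∀ i M f → dom f ⊆ dom (extend i M f)
  dom⊆extend i M f x∈ = let s , x∈s = ∈dom⁻ x∈ in ∈dom⁺ (fiber⊆extend i M f s x∈s)

  sketch-sound : ∀ is {s x} → x ∈ fiber (sketch is) s → ∃[ A ] I s ≡ just A × x ∈ A × x ∈ U
  sketch-sound []       {x = x} x∈ with () ← trans (sym (Vec.lookup-replicate x nothing)) (∈fiber⁻ x∈)
  sketch-sound (i ∷ is) {s} {x} x∈ with I i in eq
  ... | nothing = sketch-sound is x∈
  ... | just A with τ ≤? ∣ (A ∩ U) ─ dom (sketch is) ∣
  ...   | no  _ = sketch-sound is x∈
  ...   | yes _ with x ∈? ((A ∩ U) ─ dom (sketch is))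
  ...     | no x∉D = sketch-sound is (∈fiber-assign-∉ x∉D x∈)
  ...     | yes x∈D with refl ← ∈fiber-assign-∈ {f = sketch is} x∈D x∈ =
    A , eq , x∈p∩q⁻ A U (p─q⊆p (A ∩ U) _ x∈D)

  -- A fiber becomes nonempty only by receiving a piece of at least `τ` elements, and it never
  -- shrinks afterwards.
  sketch-dense : ∀ is {s x} → x ∈ fiber (sketch is) s → τ ≤ ∣ fiber (sketch is) s ∣
  sketch-dense []       {x = x} x∈ with () ← trans (sym (Vec.lookup-replicate x nothing)) (∈fiber⁻ x∈)
  sketch-dense (i ∷ is) {s} {x} x∈ = extend-dense (I i) (sketch-dense is) x∈
    where
    extend-dense : ∀ M {f} → (∀ {s x} → x ∈ fiber f s → τ ≤ ∣ fiber f s ∣) →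
                   ∀ {s x} → x ∈ fiber (extend i M f) s → τ ≤ ∣ fiber (extend i M f) s ∣
    extend-dense nothing  dense x∈ = dense x∈
    extend-dense (just A) {f} dense {s} {x} x∈ with fiber⊆extend i (just A) f s
    ... | grow with τ ≤? ∣ (A ∩ U) ─ dom f ∣
    ...   | no  _   = dense x∈
    ...   | yes τ≤D with x ∈? ((A ∩ U) ─ dom f)
    ...     | no x∉D = ≤-trans (dense (∈fiber-assign-∉ x∉D x∈))
                               (p⊆q⇒∣p∣≤∣q∣ {p = fiber f s} grow)
    ...     | yes x∈D with refl ← ∈fiber-assign-∈ {f = f} x∈D x∈ =
      ≤-trans τ≤D (p⊆q⇒∣p∣≤∣q∣ {p = (A ∩ U) ─ dom f} λ y∈D → ∈fiber⁺ (lookup-assign-∈ y∈D))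

  -- When `i` is scanned, its new part is either refused for being below `τ` or absorbed entirely,
  -- leaving 0 < `τ`. Later steps only enlarge the domain, so the residue cannot grow.
  sketch-maximal : 0 < τ → ∀ is {i A} → i ∈ᴸ is → I i ≡ just A → ∣ (A ∩ U) ─ dom (sketch is) ∣ < τ
  sketch-maximal 0<τ (i ∷ is) {A = A} (here refl) eq with I i
  sketch-maximal 0<τ (i ∷ is) {A = A} (here refl) refl | just A with τ ≤? ∣ (A ∩ U) ─ dom (sketch is) ∣
  ... | no  τ≰D = ≰⇒> τ≰D
  ... | yes _   = ≤-<-trans (≤-reflexive (p⊆q⇒∣p─q∣≡0 {p = A ∩ U} taken)) 0<τ
    where
    taken : A ∩ U ⊆ dom (assign i ((A ∩ U) ─ dom (sketch is)) (sketch is))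
    taken {x} x∈ with x ∈? dom (sketch is)
    ... | no x∉ = ∈dom⁺ (∈fiber⁺ (lookup-assign-∈ (x∈p∧x∉q⇒x∈p─q x∈ x∉)))
    ... | yes x∈dom = let s , x∈s = ∈dom⁻ x∈dom in
      ∈dom⁺ (∈fiber⁺ (trans (lookup-assign-∉ λ x∈D → x∈p─q⇒x∉q (A ∩ U) _ x∈D x∈dom) (∈fiber⁻ x∈s)))
  sketch-maximal 0<τ (i ∷ is) {A = A} (there i∈) eq = ≤-<-trans
    (p⊆q⇒∣p∣≤∣q∣ {p = (A ∩ U) ─ dom (extend i (I i) (sketch is))} λ x∈ → x∈p∧x∉q⇒x∈p─q
      (p─q⊆p (A ∩ U) _ x∈)
      (λ x∈dom → x∈p─q⇒x∉q (A ∩ U) _ x∈ (dom⊆extend i (I i) (sketch is) x∈dom)))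
    (sketch-maximal 0<τ is i∈ eq)

  dom-sketch⊆ : ∀ is → dom (sketch is) ⊆ U
  dom-sketch⊆ is x∈ = let _ , x∈s = ∈dom⁻ x∈; _ , _ , _ , x∈U = sketch-sound is x∈s in x∈U

-- The coordinator's selection

Piece : (n m : ℕ) → Set
Piece n m = Fin m × Subset n

cov : ∀ {n m} → List (Piece n m) → Subset n
cov l = ⋃ (map proj₂ l)

module Select {n m : ℕ} (τ a : ℕ) where

  select : List (Piece n m) → List (Piece n m) → List (Piece n m)
  select []       l = l
  select (q ∷ qs) l with τ ≤? a * ∣ proj₂ q ─ cov (select qs l) ∣
  ... | yes _ = q ∷ select qs l
  ... | no  _ = select qs l

  -- Every piece contributed at least τ / a new elements when it was added.
  data Productive : List (Piece n m) → Set where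
    []  : Productive []
    _∷_ : ∀ {q l} → τ ≤ a * ∣ proj₂ q ─ cov l ∣ → Productive l → Productive (q ∷ l)

  select-productive : ∀ qs {l} → Productive l → Productive (select qs l)
  select-productive []       pr = pr
  select-productive (q ∷ qs) {l} pr with τ ≤? a * ∣ proj₂ q ─ cov (select qs l) ∣
  ... | yes τ≤ = τ≤ ∷ select-productive qs pr
  ... | no  _  = select-productive qs pr

  select-All : ∀ {P : Piece n m → Set} {qs l} → All P qs → All P l → All P (select qs l)
  select-All []         pl = pl
  select-All {qs = q ∷ qs} {l} (pq ∷ pqs) pl with τ ≤? a * ∣ proj₂ q ─ cov (select qs l) ∣
  ... | yes _ = pq ∷ select-All pqs pl
  ... | no  _ = select-All pqs pl

  cov⊆select : ∀ qs {l} → cov l ⊆ cov (select qs l)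
  cov⊆select []       x∈ = x∈
  cov⊆select (q ∷ qs) {l} x∈ with τ ≤? a * ∣ proj₂ q ─ cov (select qs l) ∣
  ... | yes _ = x∈p∪q⁺ (inj₂ (cov⊆select qs x∈))
  ... | no  _ = cov⊆select qs x∈

  -- As for sketches: a refused piece adds too little, an accepted one leaves no residue, and the
  -- cover only grows.
  select-maximal : 0 < τ → ∀ qs {l q} → q ∈ᴸ qs → a * ∣ proj₂ q ─ cov (select qs l) ∣ < τ
  select-maximal 0<τ (q ∷ qs) {l} (here refl) with τ ≤? a * ∣ proj₂ q ─ cov (select qs l) ∣
  ... | yes _ = ≤-<-trans (p⊆q⇒a*∣p─q∣≤b a {p = proj₂ q} λ x∈ → x∈p∪q⁺ (inj₁ x∈)) 0<τ
  ... | no τ≰ = ≰⇒> τ≰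
  select-maximal 0<τ (q ∷ qs) {l} {q′} (there q′∈) with τ ≤? a * ∣ proj₂ q ─ cov (select qs l) ∣
  ... | no  _ = select-maximal 0<τ qs q′∈
  ... | yes _ = ≤-<-trans (*-monoʳ-≤ a (p⊆q⇒∣p∣≤∣q∣ {p = proj₂ q′ ─ cov (q ∷ select qs l)} λ x∈ →
                  x∈p∧x∉q⇒x∈p─q (p─q⊆p (proj₂ q′) _ x∈)
                    (λ x∈c → x∈p─q⇒x∉q (proj₂ q′) _ x∈ (x∈p∪q⁺ (inj₂ x∈c)))))
                (select-maximal 0<τ qs q′∈)

  -- Each contribution is disjoint from the cover before it, so the contributions sum to the size of
  -- the final cover.
  productive-large : ∀ {l} → Productive l → length l * τ ≤ a * ∣ cov l ∣
  productive-large [] = z≤n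
  productive-large (_∷_ {q} {l} τ≤ pr) = begin
    τ + length l * τ                          ≤⟨ +-mono-≤ τ≤ (productive-large pr) ⟩
    a * ∣ proj₂ q ─ cov l ∣ + a * ∣ cov l ∣   ≡⟨ *-distribˡ-+ a _ _ ⟨
    a * (∣ proj₂ q ─ cov l ∣ + ∣ cov l ∣)     ≡⟨ cong (a *_) (∣p─q∣+∣q∣≡∣p∪q∣ (proj₂ q) (cov l)) ⟩
    a * ∣ proj₂ q ∪ cov l ∣                   ∎
    where open ≤-Reasoning

  Within : SetFamily n m → Piece n m → Set
  Within K (s , P) = P ⊆ K s

  ids : List (Piece n m) → Subset m
  ids l = ⋃ (map (⁅_⁆ ∘ proj₁) l)

  ∣ids∣≤length : ∀ l → ∣ ids l ∣ ≤ length l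
  ∣ids∣≤length []            = ≤-reflexive (Subset.∣⊥∣≡0 m)
  ∣ids∣≤length ((s , _) ∷ l) = ≤-trans (∣p∪q∣≤∣p∣+∣q∣ ⁅ s ⁆ (ids l))
    (+-mono-≤ (≤-reflexive (Subset.∣⁅x⁆∣≡1 s)) (∣ids∣≤length l))

  ∣cov∣≤coverage : ∀ {K l} → All (Within K) l → ∣ cov l ∣ ≤ coverage K (ids l)
  ∣cov∣≤coverage {K} {l} within = p⊆q⇒∣p∣≤∣q∣ {p = cov l} λ x∈ →
      let s , s∈ , x∈K = go within x∈ in ∈covered⁺ K (ids l) s∈ x∈K
    where
    go : ∀ {l} → All (Within K) l → ∀ {x} → x ∈ cov l → ∃[ s ] s ∈ ids l × x ∈ K s
    go [] x∈ = contradiction x∈ ∉⊥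
    go {(s , P) ∷ l} (P⊆K ∷ within) x∈ with x∈p∪q⁻ P (cov l) x∈
    ... | inj₁ x∈P = s , x∈p∪q⁺ (inj₁ (Subset.x∈⁅x⁆ s)) , P⊆K x∈P
    ... | inj₂ x∈l with go within x∈l
    ...   | s′ , s′∈ , x∈K = s′ , x∈p∪q⁺ (inj₂ s′∈) , x∈K

  module _ {K : SetFamily n m} {k : ℕ} {T : Subset m} (opt : Optimal K k T) where

    short : ∀ {l} → All (Within K) l → length l ≤ k → ∣ cov l ∣ ≤ coverage K T
    short {l} within len≤k = ≤-trans (∣cov∣≤coverage within)
      (proj₂ opt (ids l) (≤-trans (∣ids∣≤length l) len≤k))

    -- A tail of a productive list is productive, so pieces are dropped from the front until exactly
    -- `k` remain. These form an admissible choice, whose cover is at most the optimum.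
    long : ∀ {l} → Productive l → All (Within K) l → k ≤ length l → k * τ ≤ a * coverage K T
    long {l} pr within k≤len with length l ≤? k
    long {l} pr within k≤len | yes len≤k = begin
      k * τ             ≤⟨ *-monoˡ-≤ τ k≤len ⟩
      length l * τ      ≤⟨ productive-large pr ⟩
      a * ∣ cov l ∣     ≤⟨ *-monoʳ-≤ a (short within len≤k) ⟩
      a * coverage K T  ∎
      where open ≤-Reasoning
    long {[]}    _        _            _ | no len≰k = contradiction z≤n len≰k
    long {_ ∷ _} (_ ∷ pr) (_ ∷ within) _ | no len≰k = long pr within (s≤s⁻¹ (≰⇒> len≰k))

    optimum-vs-productive : ∀ {l} → Productive l → All (Within K) l →
                            k * τ ≤ a * coverage K T ⊎ ∣ cov l ∣ ≤ coverage K T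
    optimum-vs-productive {l} pr within with ≤-total (length l) k
    ... | inj₁ len≤k = inj₂ (short within len≤k)
    ... | inj₂ k≤len = inj₁ (long pr within k≤len)

-- Binary codes

-- Codes have fixed width and `parse` returns the unread bits, so codes can be concatenated without
-- delimiters and lengths are known exactly.
record Codec (A : Set) (w : ℕ) : Set where
  field
    encode        : A → Bits
    length-encode : ∀ x → length (encode x) ≡ w
    parse         : Bits → A × Bits
    parse-encode  : ∀ x rest → parse (encode x ++ rest) ≡ (x , rest)

  decode : Bits → A
  decode = proj₁ ∘ parse

  decode-encode : ∀ x → decode (encode x) ≡ x
  decode-encode x =
    trans (cong decode (sym (++-identityʳ (encode x)))) (cong proj₁ (parse-encode x []))

open Codec

bool : Codec Bool 1
bool .encode b = b ∷ []
bool .length-encode _ = refl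
-- The default only makes parsing total; the round-trip law never meets an empty string here.
bool .parse []       = false , []
bool .parse (b ∷ bs) = b , bs
bool .parse-encode _ _ = refl

_×ᶜ_ : ∀ {A B v w} → Codec A v → Codec B w → Codec (A × B) (v + w)
(c ×ᶜ d) .encode (x , y) = encode c x ++ encode d y
(c ×ᶜ d) .length-encode (x , y) =
  trans (length-++ (encode c x)) (cong₂ _+_ (length-encode c x) (length-encode d y))
(c ×ᶜ d) .parse bs = let x , bs′ = parse c bs; y , bs″ = parse d bs′ in (x , y) , bs″
(c ×ᶜ d) .parse-encode (x , y) rest
  rewrite ++-assoc (encode c x) (encode d y) rest
        | parse-encode c x (encode d y ++ rest)
        | parse-encode d y rest = refl

retract : ∀ {A B w} (f : B → A) (g : A → B) → (∀ y → g (f y) ≡ y) → Codec A w → Codec B w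
retract f g gf c .encode = encode c ∘ f
retract f g gf c .length-encode = length-encode c ∘ f
retract f g gf c .parse bs = let x , rest = parse c bs in g x , rest
retract f g gf c .parse-encode y rest
  rewrite parse-encode c (f y) rest = cong (_, rest) (gf y)

vec : ∀ {A w} n → Codec A w → Codec (Vec A n) (n * w)
vec zero c .encode []         = []
vec zero c .length-encode []  = refl
vec zero c .parse bs          = [] , bs
vec zero c .parse-encode [] _ = refl
vec (suc n) c = retract (λ { (x ∷ xs) → x , xs }) (λ (x , xs) → x ∷ xs) (λ { (_ ∷ _) → refl })
                        (c ×ᶜ vec n c)

fin : ∀ w → Codec (Fin (2 ^ w)) w
fin zero .encode zero         = []
fin zero .length-encode zero  = refl
fin zero .parse bs            = zero , bs
fin zero .parse-encode zero _ = refl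
fin (suc w) = retract (remQuot {2} (2 ^ w)) (uncurry combine)
                      (Fin.combine-remQuot {2} (2 ^ w)) (bit ×ᶜ fin w)
  where
  bit : Codec (Fin 2) 1
  bit = retract (λ { zero → false ; (suc zero) → true }) (if_then suc zero else zero)
                (λ { zero → refl ; (suc zero) → refl }) bool

optional : ∀ {m w} → m < 2 ^ w → Codec (Maybe (Fin m)) w
optional {m} {w} m<2^w = retract to from from-to (fin w)
  where
  index : Maybe (Fin m) → Fin (suc m)
  -- Code 0 is reserved for `nothing`, so m + 1 codes are needed; `m<2^w` says exactly that they
  -- fit.
  index nothing  = zero
  index (just i) = suc i
  to : Maybe (Fin m) → Fin (2 ^ w)
  to = λ x → inject≤ (index x) m<2^w
  back : ∀ {j} → Dec (j < suc m) → Maybe (Fin m)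
  back (no _)                      = nothing
  back {zero}  (yes _)             = nothing
  back {suc j} (yes j<m) = just (fromℕ< (s≤s⁻¹ j<m))
  from : Fin (2 ^ w) → Maybe (Fin m)
  from j = back (toℕ j <? suc m)
  from-to : ∀ x → from (to x) ≡ x
  from-to x with toℕ (to x) | Fin.toℕ-inject≤ (index x) m<2^w
  from-to nothing  | _ | refl = refl
  from-to (just i) | _ | refl with suc (toℕ i) <? suc m
  ... | yes i<m = cong just (Fin.fromℕ<-toℕ i (s≤s⁻¹ i<m))
  ... | no  i≮m = contradiction (s≤s (Fin.toℕ<n i)) i≮m

-- Powers and logarithms

-- Strong induction through ⌈n/2⌉, whose logarithm is one less. For n ≥ 2 the logarithm is positive,
-- so the truncated subtraction is exact.
n≤2^⌈log₂n⌉ : ∀ n → n ≤ 2 ^ ⌈log₂ n ⌉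
n≤2^⌈log₂n⌉ = <-rec _ step
  where
  double : ∀ {n} l → 1 ≤ l → ⌈ n /2⌉ ≤ 2 ^ (l ∸ 1) → n ≤ 2 ^ l
  double {n} (suc l) _ half = begin
    n                      ≡⟨ ⌊n/2⌋+⌈n/2⌉≡n n ⟨
    ⌊ n /2⌋ + ⌈ n /2⌉      ≤⟨ +-mono-≤ (≤-trans (⌊n/2⌋≤⌈n/2⌉ n) half) half ⟩
    2 ^ l + 2 ^ l          ≡⟨ cong ((2 ^ l) +_) (+-identityʳ _) ⟨
    2 ^ suc l              ∎
    where open ≤-Reasoning
  step : ∀ n → (∀ {h} → h < n → h ≤ 2 ^ ⌈log₂ h ⌉) → n ≤ 2 ^ ⌈log₂ n ⌉
  step 0 _ = z≤n
  step 1 _ = m^n>0 2 ⌈log₂ 1 ⌉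
  step n@(suc (suc n′)) rec = double ⌈log₂ n ⌉ (⌈log₂⌉-mono-≤ {2} {n} (s≤s (s≤s z≤n)))
    (subst (λ e → ⌈ n /2⌉ ≤ 2 ^ e) (⌈log₂⌈n/2⌉⌉≡⌈log₂n⌉∸1 n) (rec (⌈n/2⌉<n n′)))

^-distribʳ-* : ∀ e a b → (a * b) ^ e ≡ a ^ e * b ^ e
^-distribʳ-* zero    a b = refl
^-distribʳ-* (suc e) a b =
  trans (cong (a * b *_) (^-distribʳ-* e a b)) ([m*n]*[o*p]≡[m*o]*[n*p] a b (a ^ e) (b ^ e))

-- An integer base within a factor 2 of the root of `k`, but never below 2. As `k` grows the base is
-- kept while it suffices and doubled otherwise; just before a doubling its power is at most the old
-- `k`, which gives the upper bound.
approximate-root : ∀ r k → ∃[ a ] 2 ≤ a × k ≤ a ^ suc r × (1 ≤ k → a ^ suc r ≤ 2 ^ suc r * k)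
approximate-root r zero = 2 , ≤-refl , z≤n , λ ()
approximate-root r 1    = 2 , ≤-refl , m^n>0 2 (suc r) , λ _ → ≤-reflexive (sym (*-identityʳ _))
approximate-root r (suc k@(suc _)) with approximate-root r k
... | a , 2≤a , k≤a^ , a^≤ with suc k ≤? a ^ suc r
...   | yes k<a^ = a , 2≤a , k<a^ , λ _ → ≤-trans (a^≤ (s≤s z≤n)) (*-monoʳ-≤ (2 ^ suc r) (n≤1+n k))
...   | no k≮a^ = 2 * a , ≤-trans 2≤a (m≤n*m a 2) , large , λ _ → small
  where
  open ≤-Reasoning
  large : suc k ≤ (2 * a) ^ suc r
  large = begin
    1 + k                     ≤⟨ +-monoˡ-≤ k (s≤s z≤n) ⟩
    k + k                     ≤⟨ +-mono-≤ k≤a^ k≤a^ ⟩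
    a ^ suc r + a ^ suc r     ≡⟨ cong ((a ^ suc r) +_) (+-identityʳ _) ⟨
    2 * a ^ suc r             ≤⟨ *-monoˡ-≤ (a ^ suc r) (*-monoʳ-≤ 2 (m^n>0 2 r)) ⟩
    2 ^ suc r * a ^ suc r     ≡⟨ ^-distribʳ-* (suc r) 2 a ⟨
    (2 * a) ^ suc r           ∎
  small : (2 * a) ^ suc r ≤ 2 ^ suc r * suc k
  small = begin
    (2 * a) ^ suc r           ≡⟨ ^-distribʳ-* (suc r) 2 a ⟩
    2 ^ suc r * a ^ suc r     ≤⟨ *-monoʳ-≤ (2 ^ suc r) (<⇒≤ (≰⇒> k≮a^)) ⟩
    2 ^ suc r * suc k         ∎

-- The search stops at the first failure of `P`. It supplies the guess: a threshold that is small
-- enough while its double is too large.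
crossing : ∀ {P : ℕ → Set} → (∀ i → Dec (P i)) → P 0 → ∀ N → ¬ P N →
           ∃[ g ] P (toℕ {N} g) × ¬ P (suc (toℕ g))
crossing P? p0 zero    ¬p = contradiction p0 ¬p
crossing {P} P? p0 (suc N) ¬p with P? 1
... | no ¬p1 = zero , p0 , ¬p1
... | yes p1 = let g , pg , ¬pg = crossing (P? ∘ suc) p1 N ¬p in suc g , pg , ¬pg

-- The embedding of ℕ into ℚ

toℚᵘ-ℕ→ℚ : ∀ a → ℚ.toℚᵘ (ℕ→ℚ a) ℚᵘ.≃ mkℚᵘ (ℤ.+ a) 0
toℚᵘ-ℕ→ℚ a = ℚ.toℚᵘ-fromℚᵘ (mkℚᵘ (ℤ.+ a) 0)

ℕ→ℚ-homo-* : ∀ a b → ℕ→ℚ (a * b) ≡ ℕ→ℚ a ℚ.* ℕ→ℚ b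
ℕ→ℚ-homo-* a b = ℚ.toℚᵘ-injective (begin
  ℚ.toℚᵘ (ℕ→ℚ (a * b))                      ≈⟨ toℚᵘ-ℕ→ℚ (a * b) ⟩
  mkℚᵘ (ℤ.+ (a * b)) 0                        ≡⟨ cong (λ i → mkℚᵘ i 0) (ℤ.pos-* a b) ⟩
  mkℚᵘ (ℤ.+ a) 0 ℚᵘ.* mkℚᵘ (ℤ.+ b) 0            ≈⟨ ℚᵘ.*-cong (toℚᵘ-ℕ→ℚ a) (toℚᵘ-ℕ→ℚ b) ⟨
  ℚ.toℚᵘ (ℕ→ℚ a) ℚᵘ.* ℚ.toℚᵘ (ℕ→ℚ b)        ≈⟨ ℚ.toℚᵘ-homo-* (ℕ→ℚ a) (ℕ→ℚ b) ⟨
  ℚ.toℚᵘ (ℕ→ℚ a ℚ.* ℕ→ℚ b)                  ∎)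
  where open ℚᵘ.≃-Reasoning

ℕ→ℚ-homo-^ : ∀ a e → ℕ→ℚ (a ^ e) ≡ ℕ→ℚ a ^ℚ e
ℕ→ℚ-homo-^ a zero    = refl
ℕ→ℚ-homo-^ a (suc e) = trans (ℕ→ℚ-homo-* a (a ^ e)) (cong (ℕ→ℚ a ℚ.*_) (ℕ→ℚ-homo-^ a e))

ℕ→ℚ-mono-≤ : ∀ {a b} → a ≤ b → ℕ→ℚ a ℚ.≤ ℕ→ℚ b
ℕ→ℚ-mono-≤ {a} {b} a≤b = ℚ.toℚᵘ-cancel-≤ (begin
  ℚ.toℚᵘ (ℕ→ℚ a)   ≃⟨ toℚᵘ-ℕ→ℚ a ⟩
  mkℚᵘ (ℤ.+ a) 0     ≤⟨ *≤* (ℤ.*-monoʳ-≤-nonNeg (ℤ.+ 1) (ℤ.+≤+ a≤b)) ⟩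
  mkℚᵘ (ℤ.+ b) 0     ≃⟨ toℚᵘ-ℕ→ℚ b ⟨
  ℚ.toℚᵘ (ℕ→ℚ b)   ∎)
  where open ℚᵘ.≤-Reasoning

-- The effect of one selection, and totals over rounds

open Select using (Productive; []; _∷_; Within)

module _ {n m : ℕ} (τ a : ℕ) (f : Assignment n m)
         (dense : ∀ {s x} → x ∈ fiber f s → τ ≤ ∣ fiber f s ∣) where
  open Select {n} {m} τ a

  -- A nonempty fiber has at least `τ` elements, while `a` times its uncovered part is below `τ`. So
  -- every fiber shrinks by the factor `a`, and hence so does their union.
  selection-thins : 0 < τ → ∀ {qs l} → (∀ s → (s , fiber f s) ∈ᴸ qs) →
                    a * ∣ dom f ─ cov (select qs l) ∣ ≤ ∣ dom f ∣
  selection-thins 0<τ {qs} {l} offered =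
    ∣dom─X∣-fiberwise a f X λ s → thin s (Subset.nonempty? (fiber f s))
    where
    X = cov (select qs l)
    thin : ∀ s → Dec (∃[ x ] x ∈ fiber f s) → a * ∣ fiber f s ─ X ∣ ≤ ∣ fiber f s ∣
    thin s (yes (x , x∈)) = ≤-trans (<⇒≤ (select-maximal 0<τ qs (offered s))) (dense x∈)
    thin s (no empty)     = p⊆q⇒a*∣p─q∣≤b a {p = fiber f s} λ x∈ → contradiction (_ , x∈) empty

0<exponent : ∀ {n} l → 2 + n ≤ 2 ^ l → 1 ≤ l
0<exponent zero    (s≤s ())
0<exponent (suc _) _ = s≤s z≤n

-- With `f` the cost per round and `F` the running total, silence from round `L` on bounds the total
-- independently of the number of rounds.
bounded-rounds : ∀ {B L} (f F : ℕ → ℕ) → F 0 ≡ 0 → (∀ t → F (suc t) ≡ f t + F t) →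
                 (∀ t → f t ≤ B) → (∀ {t} → L ≤ t → f t ≡ 0) → ∀ t → F t ≤ L * B
bounded-rounds {B} {L} f F F0 F-suc f≤B f≡0 = total
  where
  early : ∀ t → F t ≤ t * B
  early zero    = ≤-reflexive F0
  early (suc t) rewrite F-suc t = +-mono-≤ (f≤B t) (early t)
  total : ∀ t → F t ≤ L * B
  total t with t ≤? L
  total t       | yes t≤L = ≤-trans (early t) (*-monoˡ-≤ B t≤L)
  total zero    | no  t≰L = contradiction z≤n t≰L
  total (suc t) | no  t≰L rewrite F-suc t | f≡0 (s≤s⁻¹ (≰⇒> t≰L)) = total t

-- The protocol

module Iterative {n m p : ℕ} (k a Λ : ℕ) (m<2^Λ : m < 2 ^ Λ) where

  -- The powers of two below 2 ^ Λ are guesses, run in parallel, of the smallest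
  -- marginal contribution worth sending.
  τ : Fin Λ → ℕ
  τ g = 2 ^ toℕ g

  0<τ : ∀ g → 0 < τ g
  0<τ g = m^n>0 2 (toℕ g)

  abstract
    messageCodec : Codec (Vec (Assignment n m) Λ) (Λ * (n * Λ))
    messageCodec = vec Λ (vec n (optional m<2^Λ))

    summaryCodec : Codec (Vec (Subset n) Λ) (Λ * (n * 1))
    summaryCodec = vec Λ (vec n bool)

  mutual
    -- Machines have no memory, so the previous sketch is recomputed from the older summaries before
    -- the newest cover is subtracted.
    remaining : Fin Λ → LocalInput n m → List Bits → Subset n
    remaining g I []       = ⊤
    remaining g I (b ∷ bs) = dom (local g I bs) ─ lookup (decode summaryCodec b) g

    local : Fin Λ → LocalInput n m → List Bits → Assignment n m
    local g I bs = Sketch.sketch (τ g) I (remaining g I bs) (allFin m)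

  heard : Fin Λ → (Fin p → Bits) → Fin p → Assignment n m
  heard g msgs j = lookup (decode messageCodec (msgs j)) g

  pieces : Fin Λ → (Fin p → Bits) → List (Piece n m)
  pieces g msgs = cartesianProductWith (λ j s → s , fiber (heard g msgs j) s) (allFin p) (allFin m)

  chosen : Fin Λ → List (Fin p → Bits) → List (Piece n m)
  chosen g []         = []
  chosen g (msgs ∷ h) = Select.select (τ g) a (pieces g msgs) (chosen g h)

  -- Pieces from all rounds and all guesses are pooled. One optimum over the pool then serves
  -- whichever guess is right, without identifying it.
  Known : List (Fin p → Bits) → Fin m → Fin n → Set
  Known h s x = Any (λ msgs → ∃[ j ] ∃[ g ] x ∈ fiber (heard g msgs j) s) h

  known? : ∀ h s → Decidable (Known h s)
  known? h s x = Any.any? (λ msgs → any? λ j → any? λ g → x ∈? fiber (heard g msgs j) s) h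

  abstract
    known : List (Fin p → Bits) → SetFamily n m
    known h s = ⟪ known? h s ⟫

    ∈known⁺ : ∀ {h s x} → Known h s x → x ∈ known h s
    ∈known⁺ {h} {s} = ∈⟪⟫⁺ (known? h s)

    ∈known⁻ : ∀ {h s x} → x ∈ known h s → Known h s x
    ∈known⁻ {h} {s} = ∈⟪⟫⁻ (known? h s)

  -- After round Λ nothing can be left to cover, so the parties fall silent.
  protocol : Protocol n m p
  protocol .Protocol.machine j I bs =
    if does (length bs <? Λ) then encode messageCodec (Vec.tabulate λ g → local g I bs) else []
  protocol .Protocol.coordinator h =
    if does (length h ≤? Λ) then encode summaryCodec (Vec.tabulate λ g → cov (chosen g h)) else []
  -- Histories list the latest round first, so this discards the silent rounds and only genuine
  -- encodings are decoded.
  protocol .Protocol.output h = optimum (known (drop (length h ∸ Λ) h)) k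

  ∈pieces : ∀ g msgs j s → (s , fiber (heard g msgs j) s) ∈ᴸ pieces g msgs
  ∈pieces g msgs j s = ∈-cartesianProductWith⁺ _ (∈-allFin j) (∈-allFin s)

  pieces-within : ∀ g msgs h → All (Within (τ g) a (known (msgs ∷ h))) (pieces g msgs)
  pieces-within g msgs h = All.tabulate λ {q} q∈ →
    case ∈-cartesianProductWith⁻ _ (allFin p) (allFin m) q∈ of λ
      { (j , s , _ , _ , refl) x∈ → ∈known⁺ (here (j , g , x∈)) }

  known-mono : ∀ msgs h s → known h s ⊆ known (msgs ∷ h) s
  known-mono msgs h s x∈ = ∈known⁺ (there (∈known⁻ x∈))

  chosen-productive : ∀ g h → Productive (τ g) a (chosen g h)
  chosen-productive g []         = []
  chosen-productive g (msgs ∷ h) =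
    Select.select-productive (τ g) a (pieces g msgs) (chosen-productive g h)

  chosen-within : ∀ g h → All (Within (τ g) a (known h)) (chosen g h)
  chosen-within g []         = []
  chosen-within g (msgs ∷ h) = Select.select-All (τ g) a (pieces-within g msgs h)
    (All.map (λ {(s , _)} P⊆ {_} x∈ → known-mono msgs h s (P⊆ x∈)) (chosen-within g h))

  -- Execution on a fixed instance

  module Run (S : SetFamily n m) (owner : Partition m p) where
    open Execution protocol S owner using (received; summaries)

    length-received : ∀ t → length (received t) ≡ t
    length-received zero    = refl
    length-received (suc t) = cong suc (length-received t)

    length-summaries : ∀ t → length (summaries t) ≡ t
    length-summaries zero    = refl
    length-summaries (suc t) = cong suc (length-summaries t)

    msgs : ℕ → Fin p → Bits
    msgs t j = Protocol.machine protocol j (localInput S owner j) (summaries t)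

    sent : Fin Λ → Fin p → ℕ → Assignment n m
    sent g j t = local g (localInput S owner j) (summaries t)

    U : Fin Λ → Fin p → ℕ → Subset n
    U g j t = remaining g (localInput S owner j) (summaries t)

    X : Fin Λ → ℕ → Subset n
    X g t = cov (chosen g (received t))

    heard-sent : ∀ g j {t} → t < Λ → heard g (msgs t) j ≡ sent g j t
    heard-sent g j {t} t<Λ = begin
      lookup (decode messageCodec (msgs t j)) g
        ≡⟨ cong (λ b → lookup (decode messageCodec (if b then encode messageCodec assignments else [])) g)
                (dec-true (length (summaries t) <? Λ) (subst (_< Λ) (sym (length-summaries t)) t<Λ)) ⟩
      lookup (decode messageCodec (encode messageCodec assignments)) g
        ≡⟨ cong (λ v → lookup v g) (decode-encode messageCodec assignments) ⟩
      lookup assignments g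
        ≡⟨ Vec.lookup∘tabulate _ g ⟩
      sent g j t ∎
      where
      open ≡-Reasoning
      assignments = Vec.tabulate λ g → sent g j t

    U-suc : ∀ g j {t} → t < Λ → U g j (suc t) ≡ dom (sent g j t) ─ X g (suc t)
    U-suc g j {t} t<Λ = cong (dom (sent g j t) ─_) (begin
      lookup (decode summaryCodec (Protocol.coordinator protocol (received (suc t)))) g
        ≡⟨ cong (λ b → lookup (decode summaryCodec (if b then encode summaryCodec covers else [])) g)
                (dec-true (length (received (suc t)) ≤? Λ)
                          (subst (_≤ Λ) (sym (length-received (suc t))) t<Λ)) ⟩
      lookup (decode summaryCodec (encode summaryCodec covers)) g
        ≡⟨ cong (λ v → lookup v g) (decode-encode summaryCodec covers) ⟩
      lookup covers g
        ≡⟨ Vec.lookup∘tabulate _ g ⟩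
      X g (suc t) ∎)
      where
      open ≡-Reasoning
      covers = Vec.tabulate λ g → X g (suc t)

    localInput-owner : ∀ s → localInput S owner (owner s) s ≡ just (S s)
    localInput-owner s = cong (if_then just (S s) else nothing) (dec-true (owner s Fin.≟ owner s) refl)

    localInput-sound : ∀ {j s A} → localInput S owner j s ≡ just A → A ≡ S s
    localInput-sound {j} {s} eq with does (owner s Fin.≟ j)
    localInput-sound refl | true = refl

    -- Makes the answer honest: coverage computed from received pieces never exceeds the true
    -- coverage.
    known⊆S : ∀ {t} → t ≤ Λ → ∀ s → known (received t) s ⊆ S s
    known⊆S {t} t≤Λ s x∈ = go t t≤Λ (∈known⁻ x∈)
      where
      go : ∀ t → t ≤ Λ → ∀ {x} → Known (received t) s x → x ∈ S s
      go (suc t) t<Λ (there x∈) = go t (<⇒≤ t<Λ) x∈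
      go (suc t) t<Λ {x} (here (j , g , x∈))
        with Sketch.sketch-sound (τ g) _ _ (allFin m)
               (subst (λ f → x ∈ fiber f s) (heard-sent g j t<Λ) x∈)
      ... | A , eq , x∈A , _ = subst (x ∈_) (localInput-sound {j} eq) x∈A

    dense : ∀ g j t {s x} → x ∈ fiber (sent g j t) s → τ g ≤ ∣ fiber (sent g j t) s ∣
    dense g j t = Sketch.sketch-dense (τ g) _ _ (allFin m)

    sent-offered : ∀ g j {t} → t < Λ → ∀ s → (s , fiber (sent g j t) s) ∈ᴸ pieces g (msgs t)
    sent-offered g j {t} t<Λ s =
      subst (λ f → (s , fiber f s) ∈ᴸ pieces g (msgs t)) (heard-sent g j t<Λ) (∈pieces g (msgs t) j s)

    U-shrinks : ∀ g j {t} → t < Λ → a * ∣ U g j (suc t) ∣ ≤ ∣ dom (sent g j t) ∣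
    U-shrinks g j {t} t<Λ rewrite U-suc g j t<Λ =
      selection-thins (τ g) a (sent g j t) (dense g j t) (0<τ g) (sent-offered g j t<Λ)

    sent⊆U : ∀ g j t → ∣ dom (sent g j t) ∣ ≤ ∣ U g j t ∣
    sent⊆U g j t = p⊆q⇒∣p∣≤∣q∣ (Sketch.dom-sketch⊆ (τ g) _ _ (allFin m))

    -- The comparison is with the first message instead of the initial remainder `⊤`: the message
    -- can be bounded by the value of the answer, whereas `⊤` has size n.
    U-geometric : ∀ g j {t} → 1 ≤ t → t ≤ Λ → a ^ t * ∣ U g j t ∣ ≤ ∣ dom (sent g j 0) ∣
    U-geometric g j {1}           _ t≤Λ =
      subst (λ e → e * ∣ U g j 1 ∣ ≤ ∣ dom (sent g j 0) ∣) (sym (*-identityʳ a)) (U-shrinks g j t≤Λ)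
    U-geometric g j {suc t@(suc _)} _ t<Λ = begin
      a * a ^ t * ∣ U g j (suc t) ∣     ≡⟨ cong (_* ∣ U g j (suc t) ∣) (*-comm a (a ^ t)) ⟩
      a ^ t * a * ∣ U g j (suc t) ∣     ≡⟨ *-assoc (a ^ t) a _ ⟩
      a ^ t * (a * ∣ U g j (suc t) ∣)
        ≤⟨ *-monoʳ-≤ (a ^ t) (≤-trans (U-shrinks g j t<Λ) (sent⊆U g j t)) ⟩
      a ^ t * ∣ U g j t ∣               ≤⟨ U-geometric g j (s≤s z≤n) (<⇒≤ t<Λ) ⟩
      ∣ dom (sent g j 0) ∣              ∎
      where open ≤-Reasoning

    X-mono : ∀ g t → X g t ⊆ X g (suc t)
    X-mono g t = Select.cov⊆select (τ g) a (pieces g (msgs t))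

    -- An uncovered element of `S s` leaves the remainder in a round only if the sketch refuses it,
    -- and by maximality at most `τ g ∸ 1` elements of `S s` are refused per round.
    missed : ∀ g s t → t ≤ Λ → ∣ (S s ─ X g t) ─ U g (owner s) t ∣ ≤ t * (τ g ∸ 1)
    missed g s zero    _   = ≤-reflexive (p⊆q⇒∣p─q∣≡0 {p = S s ─ X g 0} λ _ → Subset.∈⊤)
    missed g s (suc t) t<Λ rewrite U-suc g (owner s) t<Λ = begin
      ∣ (S s ─ X′) ─ (D ─ X′) ∣
        ≤⟨ p⊆q∪r⇒∣p∣≤∣q∣+∣r∣ ((S s ∩ U₀) ─ D) ((S s ─ X g t) ─ U₀) split ⟩
      ∣ (S s ∩ U₀) ─ D ∣ + ∣ (S s ─ X g t) ─ U₀ ∣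
        ≤⟨ +-mono-≤ (∸-monoˡ-≤ 1 new) (missed g s t (<⇒≤ t<Λ)) ⟩
      τ g ∸ 1 + t * (τ g ∸ 1)                          ∎
      where
      open ≤-Reasoning
      X′ = X g (suc t)
      U₀ = U g (owner s) t
      D  = dom (sent g (owner s) t)
      new : suc ∣ (S s ∩ U₀) ─ D ∣ ≤ τ g
      new = Sketch.sketch-maximal (τ g) _ _ (0<τ g) (allFin m) (∈-allFin s) (localInput-owner s)
      -- Such an element lies outside `D`. If it was in `U₀` it was refused in this round; otherwise
      -- it had been lost before, since covers only grow.
      split : (S s ─ X′) ─ (D ─ X′) ⊆ ((S s ∩ U₀) ─ D) ∪ ((S s ─ X g t) ─ U₀)
      split {x} x∈ with p─q⊆p (S s ─ X′) _ x∈ | x∈p─q⇒x∉q (S s ─ X′) (D ─ X′) x∈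
      ... | x∈S─X′ | x∉D─X′ with p─q⊆p (S s) X′ x∈S─X′ | x∈p─q⇒x∉q (S s) X′ x∈S─X′ | x ∈? U₀
      ...   | x∈S | x∉X′ | yes x∈U₀ = x∈p∪q⁺ (inj₁ (x∈p∧x∉q⇒x∈p─q (x∈p∩q⁺ (x∈S , x∈U₀))
                λ x∈D → x∉D─X′ (x∈p∧x∉q⇒x∈p─q x∈D x∉X′)))
      ...   | x∈S | x∉X′ | no x∉U₀  = x∈p∪q⁺ (inj₂ (x∈p∧x∉q⇒x∈p─q
                (x∈p∧x∉q⇒x∈p─q x∈S λ x∈X → x∉X′ (X-mono g t x∈X)) x∉U₀))

    first⊆known : ∀ t s → known (received 1) s ⊆ known (received (suc t)) s
    first⊆known zero    s x∈ = x∈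
    first⊆known (suc t) s x∈ = known-mono (msgs (suc t)) (received (suc t)) s (first⊆known t s x∈)

    -- The first selection `C` misses at most a fraction 1/a ≤ 1/2 of the message `D`, so |D| ≤
    -- 2|C|. The dichotomy for productive lists, applied to `C`, does the rest, as the first pieces
    -- stay known.
    first-round : ∀ g j {t T} → 1 ≤ t → t ≤ Λ → 2 ≤ a → Optimal (known (received t)) k T →
                  k * τ g ≤ a * coverage (known (received t)) T ⊎
                  ∣ dom (sent g j 0) ∣ ≤ 2 * coverage (known (received t)) T
    first-round g j {suc t} {T} _ t<Λ 2≤a opt
      with Select.optimum-vs-productive (τ g) a {K = known (received (suc t))} opt
             (Select.select-productive (τ g) a (pieces g (msgs 0)) [])
             (Select.select-All (τ g) a
               (All.map (λ {(s , _)} P⊆ {_} x∈ → first⊆known t s (P⊆ x∈))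
                        (pieces-within g (msgs 0) [])) [])
    ... | inj₁ large = inj₁ large
    ... | inj₂ small = inj₂ (+-cancelˡ-≤ ∣ D ∣ _ _ (begin
      ∣ D ∣ + ∣ D ∣                       ≡⟨ cong (∣ D ∣ +_) (+-identityʳ ∣ D ∣) ⟨
      2 * ∣ D ∣                           ≤⟨ *-monoʳ-≤ 2 (∣p∣≤∣p─q∣+∣q∣ D C) ⟩
      2 * (∣ D ─ C ∣ + ∣ C ∣)             ≡⟨ *-distribˡ-+ 2 ∣ D ─ C ∣ ∣ C ∣ ⟩
      2 * ∣ D ─ C ∣ + 2 * ∣ C ∣
        ≤⟨ +-mono-≤ (*-monoˡ-≤ ∣ D ─ C ∣ 2≤a) (*-monoʳ-≤ 2 small) ⟩
      a * ∣ D ─ C ∣ + 2 * v               ≤⟨ +-monoˡ-≤ (2 * v) thin ⟩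
      ∣ D ∣ + 2 * v                       ∎))
      where
      open ≤-Reasoning
      v = coverage (known (received (suc t))) T
      D = dom (sent g j 0)
      C = cov (Select.select (τ g) a (pieces g (msgs 0)) [])
      thin : a * ∣ D ─ C ∣ ≤ ∣ D ∣
      thin = selection-thins (τ g) a (sent g j 0) (dense g j 0) (0<τ g)
               (sent-offered g j (≤-trans (s≤s z≤n) t<Λ))

    drop-received : ∀ d t → drop d (received (d + t)) ≡ received t
    drop-received zero    t = refl
    drop-received (suc d) t = drop-received d t

    result≡optimum : ∀ r → result protocol S owner r ≡ optimum (known (received (Λ ⊓ r))) k
    result≡optimum r = cong (λ h → optimum (known h) k) (begin
      drop (length (received r) ∸ Λ) (received r)
        ≡⟨ cong (λ l → drop (l ∸ Λ) (received r)) (length-received r) ⟩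
      drop (r ∸ Λ) (received r)                      ≡⟨ cong (drop (r ∸ Λ) ∘ received) r≡ ⟩
      drop (r ∸ Λ) (received ((r ∸ Λ) + (Λ ⊓ r)))    ≡⟨ drop-received (r ∸ Λ) (Λ ⊓ r) ⟩
      received (Λ ⊓ r)                               ∎)
      where
      open ≡-Reasoning
      r≡ : r ≡ (r ∸ Λ) + (Λ ⊓ r)
      r≡ = sym (trans (+-comm (r ∸ Λ) _) (m⊓n+n∸m≡n Λ r))

    -- Communication

    length-if : ∀ {A : Set} {w} (c : Codec A w) (b : Bool) x →
                length (if b then encode c x else []) ≤ w
    length-if c true  x = ≤-reflexive (length-encode c x)
    length-if c false x = z≤n

    received-bits : ∀ r j → sum (map (λ msgs → length (msgs j)) (received r)) ≤ Λ * (Λ * (n * Λ))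
    received-bits r j = bounded-rounds (λ t → length (msgs t j))
      (λ r → sum (map (λ msgs → length (msgs j)) (received r))) refl (λ _ → refl)
      (λ t → length-if messageCodec (does (length (summaries t) <? Λ)) _)
      (λ {t} Λ≤t → cong
        (λ b → length (if b then encode messageCodec (Vec.tabulate λ g → sent g j t) else []))
        (dec-false (length (summaries t) <? Λ) (≤⇒≯ (subst (Λ ≤_) (sym (length-summaries t)) Λ≤t))))
      r

    summary-bits : ∀ r → sum (map length (summaries r)) ≤ Λ * (Λ * (n * 1))
    summary-bits = bounded-rounds (λ t → length (Protocol.coordinator protocol (received (suc t))))
      (λ r → sum (map length (summaries r))) refl (λ _ → refl)
      (λ t → length-if summaryCodec (does (length (received (suc t)) ≤? Λ)) _)
      (λ {t} Λ≤t → cong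
        (λ b → length (if b then encode summaryCodec (Vec.tabulate λ g → X g (suc t)) else []))
        (dec-false (length (received (suc t)) ≤? Λ)
          (<⇒≱ (subst (Λ <_) (sym (length-received (suc t))) (s≤s Λ≤t)))))

    communication≤ : 1 ≤ Λ → ∀ r j → communication protocol S owner r j ≤ 2 * n * Λ ^ 3
    communication≤ 1≤Λ r j = begin
      communication protocol S owner r j
        ≤⟨ +-mono-≤ (received-bits r j) (summary-bits (r ∸ 1)) ⟩
      Λ * (Λ * (n * Λ)) + Λ * (Λ * (n * 1))
        ≤⟨ +-monoʳ-≤ (Λ * (Λ * (n * Λ))) (*-monoʳ-≤ Λ (*-monoʳ-≤ Λ (*-monoʳ-≤ n 1≤Λ))) ⟩
      Λ * (Λ * (n * Λ)) + Λ * (Λ * (n * Λ))          ≡⟨ lemma n Λ ⟩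
      2 * n * Λ ^ 3                                  ∎
      where
      open ≤-Reasoning
      lemma : ∀ n l → l * (l * (n * l)) + l * (l * (n * l)) ≡ 2 * n * (l * (l * (l * 1)))
      lemma = solve-∀

    -- The approximation ratio

    module _ {r : ℕ} (1≤r : 1 ≤ r) (1≤k : 1 ≤ k) (2≤a : 2 ≤ a) (k≤a^[1+r] : k ≤ a ^ suc r)
             (2+n≤2^Λ : 2 + n ≤ 2 ^ Λ) where

      R : ℕ
      R = Λ ⊓ r

      R≤Λ : R ≤ Λ
      R≤Λ = m⊓n≤m Λ r

      1≤R : 1 ≤ R
      1≤R = ⊓-glb (0<exponent Λ 2+n≤2^Λ) 1≤r

      -- If all `r` rounds are effective, geometric decay and k ≤ a^(r+1) give the bound. If the
      -- protocol fell silent at `Λ`, the remainder is already empty.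
      k*∣U∣≤ : ∀ g j {w} → ∣ dom (sent g j 0) ∣ ≤ w → k * ∣ U g j R ∣ ≤ a * w
      k*∣U∣≤ g j {w} D≤w = case ⊓-sel Λ r of λ
        { (inj₁ R≡Λ) → exhausted R≡Λ
        ; (inj₂ R≡r) → begin
            k * u                   ≤⟨ *-monoˡ-≤ u k≤a^[1+r] ⟩
            a * a ^ r * u           ≡⟨ *-assoc a (a ^ r) u ⟩
            a * (a ^ r * u)         ≡⟨ cong (λ e → a * (a ^ e * u)) R≡r ⟨
            a * (a ^ R * u)         ≤⟨ *-monoʳ-≤ a (≤-trans (U-geometric g j 1≤R R≤Λ) D≤w) ⟩
            a * w                   ∎ }
        where
        open ≤-Reasoning
        u = ∣ U g j R ∣
        exhausted : R ≡ Λ → k * u ≤ a * w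
        exhausted R≡Λ with u in eq
        ... | zero   = ≤-trans (≤-reflexive (*-zeroʳ k)) z≤n
        -- A surviving element would force a first message of at least a^Λ ≥ 2^Λ > n elements.
        ... | suc u′ = contradiction (begin-strict
          n                       <⟨ n<1+n n ⟩
          1 + n                   ≤⟨ n≤1+n (1 + n) ⟩
          2 + n                   ≤⟨ 2+n≤2^Λ ⟩
          2 ^ Λ                   ≤⟨ ^-monoˡ-≤ Λ 2≤a ⟩
          a ^ Λ                   ≡⟨ cong (a ^_) R≡Λ ⟨
          a ^ R                   ≤⟨ m≤m*n (a ^ R) (suc u′) ⟩
          a ^ R * suc u′          ≡⟨ cong (a ^ R *_) eq ⟨
          a ^ R * ∣ U g j R ∣     ≤⟨ U-geometric g j 1≤R R≤Λ ⟩
          ∣ dom (sent g j 0) ∣    ≤⟨ Subset.∣p∣≤n (dom (sent g j 0)) ⟩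
          n                       ∎) (<-irrefl refl)

      approximates : ∀ {T} → Optimal (known (received R)) k T →
                     ∀ T* → ∣ T* ∣ ≤ k →
                     coverage S T* ≤ 8 * (r * a) * coverage (known (received R)) T
      approximates {T} opt T* T*≤k = conclude (k * τ g ≤? a * v)
        where
        open ≤-Reasoning
        instance
          k≢0 : NonZero k
          k≢0 = >-nonZero 1≤k
          r≢0 : NonZero r
          r≢0 = >-nonZero 1≤r
        v OPT : ℕ
        v   = coverage (known (received R)) T
        OPT = coverage S T*
        -- The threshold loses at most r k (τ ∸ 1) elements in all, so fitting means a loss of at
        -- most OPT / 4. Because of the `∸ 1`, the guess τ = 1 always fits, however small OPT is.
        Fits : ℕ → Set
        Fits i = (2 ^ i ∸ 1) * (4 * (r * k)) ≤ OPT
        guess : ∃[ g ] Fits (toℕ {Λ} g) × ¬ Fits (suc (toℕ g))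
        -- The last guess fails because OPT ≤ n < 2^Λ ∸ 1.
        guess = crossing (λ i → (2 ^ i ∸ 1) * (4 * (r * k)) ≤? OPT) z≤n Λ (<⇒≱ (begin-strict
          OPT                           ≤⟨ Subset.∣p∣≤n (covered S T*) ⟩
          n                             <⟨ n<1+n n ⟩
          1 + n                         ≤⟨ ∸-monoˡ-≤ 1 2+n≤2^Λ ⟩
          2 ^ Λ ∸ 1
            ≤⟨ m≤m*n (2 ^ Λ ∸ 1) (4 * (r * k)) {{m*n≢0 4 (r * k) {{_}} {{m*n≢0 r k}}}} ⟩
          (2 ^ Λ ∸ 1) * (4 * (r * k))   ∎))
        g = proj₁ guess
        q = τ g ∸ 1

        conclude : Dec (k * τ g ≤ a * v) → OPT ≤ 8 * (r * a) * v
        -- Here the failure of the doubled threshold bounds OPT by 8 r k τ.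
        conclude (yes kτ≤av) = begin
          OPT                                   ≤⟨ <⇒≤ (≰⇒> (proj₂ (proj₂ guess))) ⟩
          (2 * τ g ∸ 1) * (4 * (r * k))         ≤⟨ *-monoˡ-≤ (4 * (r * k)) (m∸n≤m (2 * τ g) 1) ⟩
          2 * τ g * (4 * (r * k))               ≡⟨ lemma (τ g) r k ⟩
          8 * r * (k * τ g)                     ≤⟨ *-monoʳ-≤ (8 * r) kτ≤av ⟩
          8 * r * (a * v)                       ≡⟨ lemma′ r a v ⟩
          8 * (r * a) * v                       ∎
          where
          lemma : ∀ t r k → 2 * t * (4 * (r * k)) ≡ 8 * r * (k * t)
          lemma = solve-∀
          lemma′ : ∀ r a v → 8 * r * (a * v) ≡ 8 * (r * a) * v
          lemma′ = solve-∀
        -- Four copies of OPT are bounded; the threshold loss absorbs one of them. The other three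
        -- are at most 4v + 8av ≤ 16av, enlarged to 24rav so that 3 cancels.
        conclude (no kτ≰av) = *-cancelˡ-≤ 3 (+-cancelˡ-≤ OPT _ _ (begin
          OPT + 3 * OPT                                     ≡⟨⟩
          4 * OPT                                           ≤⟨ *-monoʳ-≤ 4 OPT≤ ⟩
          4 * (v + k * (R * q + W))                         ≡⟨ expand v k R q W ⟩
          q * (4 * (R * k)) + (4 * v + 4 * (W * k))
            ≤⟨ +-mono-≤ fits (+-monoʳ-≤ (4 * v) (*-monoʳ-≤ 4 (m/n*n≤m (a * (2 * v)) k))) ⟩
          OPT + (4 * v + 4 * (a * (2 * v)))
            ≤⟨ +-monoʳ-≤ OPT (+-monoˡ-≤ _ (*-monoˡ-≤ v 4≤8a)) ⟩
          OPT + (8 * a * v + 4 * (a * (2 * v)))             ≡⟨ cong (OPT +_) (collect a v) ⟩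
          OPT + 16 * (1 * a) * v
            ≤⟨ +-monoʳ-≤ OPT (*-monoˡ-≤ v (*-mono-≤ (m≤m+n 16 8) (*-monoˡ-≤ a 1≤r))) ⟩
          OPT + 24 * (r * a) * v                            ≡⟨ cong (OPT +_) (factor (r * a) v) ⟩
          OPT + 3 * (8 * (r * a) * v)                       ∎))
          where
          -- The bound on each machine's final remainder, whose first message has at most 2v
          -- elements. Rounding down is sound because sizes are integers.
          W = a * (2 * v) / k
          expand : ∀ v k R q W → 4 * (v + k * (R * q + W)) ≡ q * (4 * (R * k)) + (4 * v + 4 * (W * k))
          expand = solve-∀
          collect : ∀ a v → 8 * a * v + 4 * (a * (2 * v)) ≡ 16 * (1 * a) * v
          collect = solve-∀
          factor : ∀ b v → 24 * b * v ≡ 3 * (8 * b * v)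
          factor = solve-∀
          4≤8a : 4 ≤ 8 * a
          4≤8a = ≤-trans (m≤m+n 4 12) (*-monoʳ-≤ 8 2≤a)
          fits : q * (4 * (R * k)) ≤ OPT
          fits = ≤-trans (*-monoʳ-≤ q (*-monoʳ-≤ 4 (*-monoˡ-≤ k (m⊓n≤n Λ r)))) (proj₁ (proj₂ guess))
          small : ∀ {A : Set} → k * τ g ≤ a * v ⊎ A → A
          small (inj₁ kτ≤av) = contradiction kτ≤av kτ≰av
          small (inj₂ x)     = x
          ∣X∣≤v : ∣ X g R ∣ ≤ v
          ∣X∣≤v = small (Select.optimum-vs-productive (τ g) a {K = known (received R)} opt
            (chosen-productive g (received R)) (chosen-within g (received R)))
          ∣U∣≤W : ∀ j → ∣ U g j R ∣ ≤ W
          ∣U∣≤W j = begin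
            ∣ U g j R ∣               ≡⟨ m*n/n≡m _ k ⟨
            ∣ U g j R ∣ * k / k       ≡⟨ cong (_/ k) (*-comm _ k) ⟩
            k * ∣ U g j R ∣ / k
              ≤⟨ /-monoˡ-≤ k (k*∣U∣≤ g j (small (first-round g j 1≤R R≤Λ 2≤a opt))) ⟩
            W                         ∎
          lost : ∀ s → ∣ S s ─ X g R ∣ ≤ R * q + W
          lost s = ≤-trans (∣p∣≤∣p─q∣+∣q∣ (S s ─ X g R) (U g (owner s) R))
                           (+-mono-≤ (missed g s R R≤Λ) (∣U∣≤W (owner s)))
          OPT≤ : OPT ≤ v + k * (R * q + W)
          OPT≤ = ≤-trans (coverage≤∣X∣+∣T∣*B S T* (X g R) lost)
                         (+-mono-≤ ∣X∣≤v (*-monoˡ-≤ (R * q + W) T*≤k))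

-- Choice of parameters and the final bounds

import Data.Rational.Properties as ℚ

Λ : ℕ → ℕ → ℕ
Λ n m = ⌈log₂ (2 + n + m) ⌉

2+n≤2^Λ : ∀ n m → 2 + n ≤ 2 ^ Λ n m
2+n≤2^Λ n m = ≤-trans (m≤m+n (2 + n) m) (n≤2^⌈log₂n⌉ (2 + n + m))

m<2^Λ : ∀ n m → m < 2 ^ Λ n m
m<2^Λ n m = ≤-trans (s≤s (m≤n+m m (1 + n))) (n≤2^⌈log₂n⌉ (2 + n + m))

base : ℕ → ℕ → ℕ
base r k = proj₁ (approximate-root r k)

algorithm : Algorithm
algorithm r n m p k = Iterative.protocol k (base r k) (Λ n m) (m<2^Λ n m)

-- For k = 0 the bound to be met is 0 although the base is 2, so this case gets its own value.
ratio : ℕ → ℕ → ℕ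
ratio r zero      = 0
ratio r k@(suc _) = 8 * (r * base r k)

-- The constant 16 is the 8 of the ratio times the factor 2 lost in rounding the root.
ratio^≤ : ∀ r k → ratio r k ^ suc r ≤ (16 * r) ^ suc r * k
ratio^≤ r zero = z≤n
ratio^≤ r k@(suc _) = let _ , _ , _ , root^≤ = approximate-root r k in begin
  (8 * (r * a)) ^ suc r                 ≡⟨ cong (_^ suc r) (*-assoc 8 r a) ⟨
  (8 * r * a) ^ suc r                   ≡⟨ ^-distribʳ-* (suc r) (8 * r) a ⟩
  (8 * r) ^ suc r * a ^ suc r           ≤⟨ *-monoʳ-≤ ((8 * r) ^ suc r) (root^≤ (s≤s z≤n)) ⟩
  (8 * r) ^ suc r * (2 ^ suc r * k)     ≡⟨ *-assoc ((8 * r) ^ suc r) (2 ^ suc r) k ⟨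
  (8 * r) ^ suc r * 2 ^ suc r * k       ≡⟨ cong (_* k) (^-distribʳ-* (suc r) (8 * r) 2) ⟨
  (8 * r * 2) ^ suc r * k               ≡⟨ cong (λ x → x ^ suc r * k) (lemma r) ⟩
  (16 * r) ^ suc r * k                  ∎
  where
  open ≤-Reasoning
  a = base r k
  lemma : ∀ r → 8 * r * 2 ≡ 16 * r
  lemma = solve-∀

ratio-O : IsO[r·k^1/[r+1]] (λ r k → ℕ→ℚ (ratio r k))
ratio-O = 16 , λ r k _ → ℕ→ℚ-mono-≤ {0} {ratio r k} z≤n ,
  subst (ℚ._≤ ℕ→ℚ ((16 * r) ^ suc r * k)) (ℕ→ℚ-homo-^ (ratio r k) (suc r)) (ℕ→ℚ-mono-≤ (ratio^≤ r k))

coverage≡0 : ∀ {n m} (S : SetFamily n m) (T : Subset m) → ∣ T ∣ ≤ 0 → coverage S T ≤ 0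
coverage≡0 {n} S T T≤0 = begin
  coverage S T            ≤⟨ coverage≤∣X∣+∣T∣*B S T ⊥ (λ s → Subset.∣p∣≤n (S s ─ ⊥)) ⟩
  ∣ ⊥ {n} ∣ + ∣ T ∣ * n   ≤⟨ +-mono-≤ (≤-reflexive (Subset.∣⊥∣≡0 n)) (*-monoˡ-≤ n T≤0) ⟩
  0                       ∎
  where open ≤-Reasoning

module _ (r : ℕ) (1≤r : r ≥ 1) (n m p k : ℕ) (S : SetFamily n m) (owner : Partition m p) where
  open Iterative {n} {m} {p} k (base r k) (Λ n m) (m<2^Λ n m)
  open Run S owner
  open Execution protocol S owner using (received)

  private
    K : SetFamily n m
    K = known (received (Λ n m ⊓ r))

    T : Subset m
    T = optimum K k

    c≤ratio*v : ∀ T* → ∣ T* ∣ ≤ k → coverage S T* ≤ ratio r k * coverage K T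
    c≤ratio*v T* T*≤k = by-cases k refl
      where
      by-cases : ∀ k′ → k ≡ k′ → coverage S T* ≤ ratio r k′ * coverage K T
      by-cases zero    k≡0 = coverage≡0 S T* (subst (∣ T* ∣ ≤_) k≡0 T*≤k)
      by-cases (suc _) refl =
        let _ , 2≤a , k≤a^ , _ = approximate-root r k
        in approximates 1≤r (s≤s z≤n) 2≤a k≤a^ (2+n≤2^Λ n m) (optimum-optimal K k) T* T*≤k

  algorithm-approximates :
    IsApproximation (ℕ→ℚ (ratio r k)) S k (result (algorithm r n m p k) S owner r)
  algorithm-approximates = subst (IsApproximation (ℕ→ℚ (ratio r k)) S k) (sym (result≡optimum r))
    ( proj₁ (optimum-optimal K k)
    -- The ratio is proved against the coverage of the known parts; the full sets of `T` cover at
    -- least as much.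
    , λ T* (T*≤k , _) → subst (ℕ→ℚ (coverage S T*) ℚ.≤_) (ℕ→ℚ-homo-* (ratio r k) (coverage S T))
        (ℕ→ℚ-mono-≤ (≤-trans (c≤ratio*v T* T*≤k)
          (*-monoʳ-≤ (ratio r k) (coverage-mono T (known⊆S (m⊓n≤m (Λ n m) r)))))))

  algorithm-communication : ∀ j → communication (algorithm r n m p k) S owner r j ≤ 2 * n * Λ n m ^ 3
  algorithm-communication = communication≤ (0<exponent (Λ n m) (2+n≤2^Λ n m)) r

theorem3 :
    Σ[ A ∈ Algorithm ] Σ[ α ∈ (ℕ → ℕ → ℚ) ] Σ[ b ∈ (ℕ → ℕ → ℕ) ]
      IsO[r·k^1/[r+1]] α ×
      IsÕ[n] b ×
      (∀ r → r ≥ 1 → ∀ n m p k (S : SetFamily n m) (owner : Partition m p) →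
        IsApproximation (α r k) S k (result (A r n m p k) S owner r) ×
        (∀ (j : Fin p) → communication (A r n m p k) S owner r j ≤ b n m))
theorem3 = algorithm , (λ r k → ℕ→ℚ (ratio r k)) , (λ n m → 2 * n * Λ n m ^ 3) ,
  ratio-O , (2 , 3 , λ n m → ≤-refl) ,
  λ r 1≤r n m p k S owner →
    algorithm-approximates r 1≤r n m p k S owner , algorithm-communication r 1≤r n m p k S owner
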